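{- Rowmotion is the only bijective cover-closure map on a finite ground set. That is: let $E$ be a finite set and $\tau:2^E\to 2^E$ a closure operator with set of closed sets $\mathcal{L}$, and suppose that cover-closure $\xi:\mathcal{L}\to\mathcal{L}$, $\xi(X)=\tau(\mathrm{cov}(X))$, is bijective. Then there is a poset $P$ such that $\mathcal{L}$ is isomorphic to $J(P)$ and, under this identification of $\mathcal{L}$ with $J(P)$, $\xi$ is rowmotion on $J(P)$.
   Context: A closure operator on $E$ is a function $\tau:2^E\to 2^E$ such that for all $X,Y\subseteq E$: $X\subseteq\tau(X)$; $X\subseteq Y$ implies $\tau(X)\subseteq\tau(Y)$; and $\tau(\tau(X))=\tau(X)$. A set $X\subseteq E$ is closed if $\tau(X)=X$. For $X\in 2^E$, $\mathrm{cov}(X)=\{e\in E\setminus X\mid X\cup\{e\}\in\mathcal{L}\}$. Cover-closure is the map $\xi:\mathcal{L}\to\mathcal{L}$ given by $\xi(X)=\tau(\mathrm{cov}(X))$. An order ideal of a poset $P$ is a subset $I\subseteq P$ such that $y\in I$ and $x\le y$ imply $x\in I$; $J(P)\subseteq 2^P$ is the set of order ideals of $P$. The rowmotion of $I\in J(P)$ is the order ideal generated by the minimal elements of $P\setminus I$. An essentialization of $(\mathcal{L},E)$, for $\mathcal{L}\subseteq 2^E$, is a pair $(\mathcal{L}',E')$ obtained as follows. Every $e\in E'$ must be an element of $E$ such that there exist $X,Y\in\mathcal{L}$ with $e\in X$ and $e\notin Y$. Also, if $Z\subseteq E$, $|Z|>1$, is such that whenever $e\in Z$ and $e\in W\in\mathcal{L}$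 we have $Z\subseteq W$, then for any maximal such $Z$ all elements of $Z$ except one are excluded from $E'$. All other elements of $E$ are kept in $E'$. Finally $\mathcal{L}'=\{X\cap E'\mid X\in\mathcal{L}\}$. Families $\mathcal{L}_1\subseteq 2^{E_1}$ and $\mathcal{L}_2\subseteq 2^{E_2}$ are isomorphic if there exists a bijection $\varphi:E_1'\to E_2'$ such that $\varphi(\mathcal{L}_1')=\mathcal{L}_2'$; the resulting identification sends $X\in\mathcal{L}_1$ to the element $Y\in\mathcal{L}_2$ with $\varphi(X\cap E_1')=Y\cap E_2'$. -}

module Defs where

open import Level using (0ℓ)
open import Data.Bool.Properties using () renaming (_≟_ to _≟ᵇ_)
open import Data.Fin using (Fin; _≟_)
open import Data.Fin.Properties using (any?; all?)
open import Data.Fin.Subset using (Subset; _∈_; _∉_; _⊆_; _∩_; _∪_; ∁; ⁅_⁆; ∣_∣)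
open import Data.Fin.Subset.Properties using (_∈?_)
open import Data.Nat using (ℕ) renaming (_<_ to _<ⁿ_)
open import Data.Product using (∃; ∃-syntax; _×_; _,_; proj₁)
open import Data.Vec using (tabulate)
open import Data.Vec.Properties using (≡-dec)
open import Function.Bundles using (_⤖_; _⇔_; module Bijection)
open import Relation.Binary using (Rel; IsDecPartialOrder)
open import Relation.Binary.PropositionalEquality using (_≡_; _≢_)
open import Relation.Nullary using (¬?; does; _×-dec_; _→-dec_)
open import Relation.Unary using (Pred; Decidable; _≐_)

private
  variable
    n m : ℕ

-- A finite ground set is Fin n, and a family 𝓛 ⊆ 2^E is a predicate on Subset n.
Family : ℕ → Set₁
Family n = Pred (Subset n) 0ℓ

｛_｝ : {P : Pred (Fin n) 0ℓ} → Decidable P → Subset n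
｛ P? ｝ = tabulate (λ e → does (P? e))

record IsClosureOperator (τ : Subset n → Subset n) : Set where
  field
    extensive  : ∀ X → X ⊆ τ X
    monotone   : ∀ X Y → X ⊆ Y → τ X ⊆ τ Y
    idempotent : ∀ X → τ (τ X) ≡ τ X

Closed : (Subset n → Subset n) → Family n
Closed τ X = τ X ≡ X

closed? : (τ : Subset n → Subset n) → Decidable (Closed τ)
closed? τ X = ≡-dec _≟ᵇ_ (τ X) X

cov : (Subset n → Subset n) → Subset n → Subset n
cov τ X = ｛ (λ e → ¬? (e ∈? X) ×-dec closed? τ (X ∪ ⁅ e ⁆)) ｝

coverClosure : (τ : Subset n → Subset n) → IsClosureOperator τ →
               ∃ (Closed τ) → ∃ (Closed τ)
coverClosure τ isClosure (X , _) =
  τ (cov τ X) , IsClosureOperator.idempotent isClosure (cov τ X)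

OrderIdeal : Rel (Fin m) 0ℓ → Family m
OrderIdeal _≤_ I = ∀ x y → y ∈ I → x ≤ y → x ∈ I

module _ {_≤_ : Rel (Fin m) 0ℓ} (isPoset : IsDecPartialOrder _≡_ _≤_) where
  open IsDecPartialOrder isPoset using (_≤?_)

  minimals : Subset m → Subset m
  minimals S = ｛ (λ y → (y ∈? S) ×-dec
                   all? (λ z → (z ∈? S) →-dec ((z ≤? y) →-dec (z ≟ y)))) ｝

  idealGeneratedBy : Subset m → Subset m
  idealGeneratedBy S = ｛ (λ x → any? (λ y → (y ∈? S) ×-dec (x ≤? y))) ｝

  rowmotion : Subset m → Subset m
  rowmotion I = idealGeneratedBy (minimals (∁ I))

Separated : Family n → Fin n → Set
Separated 𝓛 e = (∃[ X ] 𝓛 X × e ∈ X) × (∃[ Y ] 𝓛 Y × e ∉ Y)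

Inseparable : Family n → Subset n → Set
Inseparable 𝓛 Z =
  1 <ⁿ ∣ Z ∣ × (∀ e W → e ∈ Z → 𝓛 W → e ∈ W → Z ⊆ W)

MaximalInseparable : Family n → Subset n → Set
MaximalInseparable 𝓛 Z =
  Inseparable 𝓛 Z × (∀ Z′ → Inseparable 𝓛 Z′ → Z ⊆ Z′ → Z ≡ Z′)

-- Which element of a maximal inseparable set escapes exclusion is arbitrary,
-- so a family may have several essentializations E′.  The escaping element
-- may itself fail to be separated; then it is not in E′ either.
record IsEssentialization (𝓛 : Family n) (E′ : Subset n) : Set where
  field
    separated : ∀ e → e ∈ E′ → Separated 𝓛 e
    allButOne : ∀ Z → MaximalInseparable 𝓛 Z →
                ∃[ z ] z ∈ Z
                     × (∀ e → e ∈ Z → e ≢ z → e ∉ E′)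
                     × (Separated 𝓛 z → z ∈ E′)
    othersKept : ∀ e → Separated 𝓛 e →
                 (∀ Z → MaximalInseparable 𝓛 Z → e ∉ Z) → e ∈ E′

Restrict : Family n → Subset n → Family n
Restrict 𝓛 E′ A = ∃[ X ] 𝓛 X × A ≡ X ∩ E′

-- Membership in a Subset is proof-irrelevant, so ∃ (_∈ E′) has exactly one
-- inhabitant for each element of E′.
module _ {E₁′ : Subset n} {E₂′ : Subset m} (φ : ∃ (_∈ E₁′) ⤖ ∃ (_∈ E₂′)) where

  -- B = φ(A), for A ⊆ E₁′
  IsImage : Subset n → Subset m → Set
  IsImage A B =
    ∀ y → y ∈ B ⇔ (∃[ x ] proj₁ x ∈ A × proj₁ (Bijection.to φ x) ≡ y)

  ImageFamily : Family n → Family m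
  ImageFamily 𝓐 B = ∃[ A ] 𝓐 A × IsImage A B

record Isomorphism (𝓛₁ : Family n) (𝓛₂ : Family m) : Set where
  field
    E₁′        : Subset n
    E₂′        : Subset m
    essential₁ : IsEssentialization 𝓛₁ E₁′
    essential₂ : IsEssentialization 𝓛₂ E₂′
    φ          : ∃ (_∈ E₁′) ⤖ ∃ (_∈ E₂′)
    image      : ImageFamily φ (Restrict 𝓛₁ E₁′) ≐ Restrict 𝓛₂ E₂′

  -- X ∈ 𝓛₁ is identified with Y ∈ 𝓛₂
  Identified : Subset n → Subset m → Set
  Identified X Y = IsImage φ (X ∩ E₁′) (Y ∩ E₂′)

{-# OPTIONS --safe #-}

-- Since cov E = ∅ and ξ is injective, every closed X ≠ E has cov X ≠ ∅, so a
-- closed set avoiding e can be enlarged one element at a time until e is the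
-- only element left to add: it lies in a closed M with cov M = {e}.
-- Injectivity makes M unique, so M contains every closed set avoiding e (for
-- e ∉ τ ∅).  Hence τ A is the union of τ ∅ and the τ {a} with a ∈ A, and 𝓛 is
-- identified with the order ideals of E ∖ τ ∅ under x ≤ y ⇔ x ∈ τ {y}.

module Submission where

open import Defs
open import Level using (0ℓ)
open import Data.Fin using (Fin; zero; suc; _≟_)
open import Data.Fin.Properties using (any?; all?)
open import Data.Fin.Subset
open import Data.Fin.Subset.Induction using (⊃-wellFounded; Acc; acc)
open import Data.Fin.Subset.Properties
open import Data.Nat using (ℕ; _<_; z<s)
open import Data.Nat.Properties using (<-trans)
open import Data.Product using (Σ; ∃; ∃-syntax; _×_; _,_; proj₁; proj₂; map)
open import Data.Sum using (inj₁; inj₂; [_,_]′)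
open import Data.Vec using (_∷_; here; there)
open import Data.Vec.Properties using ([]=⇒lookup; lookup⇒[]=; lookup∘tabulate)
open import Data.Vec.Properties.WithK using ([]=-irrelevant)
open import Function using (_∘_)
open import Function.Bundles
  using (_⤖_; _⇔_; mk⇔; mk↔ₛ′; module Equivalence)
open import Function.Definitions using (Bijective; Injective)
open import Function.Properties.Inverse using (↔⇒⤖)
open import Relation.Binary using (Rel; IsDecPartialOrder)
open import Relation.Binary.PropositionalEquality
  using (_≡_; refl; sym; trans; cong; subst; isEquivalence)
open import Relation.Nullary
  using (¬?; yes; no; contradiction; Reflects; proof; invert; _×-dec_; _→-dec_)
open import Relation.Nullary.Decidable using (dec-true; decidable-stable)
open import Relation.Unary using (Pred; Decidable)

open Equivalence using (to; from)

private
  variable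
    n m : ℕ

-- Membership in decidable and singleton subsets.

∈｛｝⁺ : {P : Pred (Fin n) 0ℓ} (P? : Decidable P) {e : Fin n} → P e → e ∈ ｛ P? ｝
∈｛｝⁺ P? {e} p =
  lookup⇒[]= e _ (trans (lookup∘tabulate _ e) (dec-true (P? e) p))

∈｛｝⁻ : {P : Pred (Fin n) 0ℓ} (P? : Decidable P) {e : Fin n} → e ∈ ｛ P? ｝ → P e
∈｛｝⁻ {P = P} P? {e} e∈ =
  invert (subst (Reflects (P e))
    (trans (sym (lookup∘tabulate _ e)) ([]=⇒lookup e∈)) (proof (P? e)))

∃∈-≡ : {S : Subset n} {x y : ∃ (_∈ S)} → proj₁ x ≡ proj₁ y → x ≡ y
∃∈-≡ {x = x , p} {y = .x , q} refl = cong (x ,_) ([]=-irrelevant p q)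

⁅⁆⊆ : {e : Fin n} {X : Subset n} → e ∈ X → ⁅ e ⁆ ⊆ X
⁅⁆⊆ {e = e} {X} e∈X f∈ = subst (_∈ X) (sym (x∈⁅y⁆⇒x≡y e f∈)) e∈X

∣p∣>0⇒nonempty : (p : Subset n) → 0 < ∣ p ∣ → Nonempty p
∣p∣>0⇒nonempty (inside ∷ p)  _  = zero , here
∣p∣>0⇒nonempty (outside ∷ p) 0< = map suc there (∣p∣>0⇒nonempty p 0<)

-- Numbering the elements of a subset.

element : (S : Subset n) → Fin ∣ S ∣ → ∃ (_∈ S)
element (inside ∷ S)  zero    = zero , here
element (inside ∷ S)  (suc i) = map suc there (element S i)
element (outside ∷ S) i       = map suc there (element S i)

index : (S : Subset n) → ∃ (_∈ S) → Fin ∣ S ∣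
index (inside ∷ S)  (zero  , _)       = zero
index (inside ∷ S)  (suc e , there p) = suc (index S (e , p))
index (outside ∷ S) (suc e , there p) = index S (e , p)

index-element : (S : Subset n) (i : Fin ∣ S ∣) → index S (element S i) ≡ i
index-element (inside ∷ S)  zero    = refl
index-element (inside ∷ S)  (suc i) = cong suc (index-element S i)
index-element (outside ∷ S) i       = index-element S i

element-index : (S : Subset n) (x : ∃ (_∈ S)) → element S (index S x) ≡ x
element-index (inside ∷ S)  (zero  , here)    = refl
element-index (inside ∷ S)  (suc e , there p) = cong (map suc there) (element-index S (e , p))
element-index (outside ∷ S) (suc e , there p) = cong (map suc there) (element-index S (e , p))

module Enumeration (S : Subset n) where

  label : Fin ∣ S ∣ → Fin n
  label i = proj₁ (element S i)

  label∈ : ∀ i → label i ∈ S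
  label∈ i = proj₂ (element S i)

  label-injective : ∀ {i j} → label i ≡ label j → i ≡ j
  label-injective {i} {j} eq =
    trans (sym (index-element S i)) (trans (cong (index S) (∃∈-≡ eq)) (index-element S j))

  label-surjective : ∀ {e} → e ∈ S → ∃[ i ] label i ≡ e
  label-surjective e∈S = index S (_ , e∈S) , cong proj₁ (element-index S (_ , e∈S))

  -- The target is all of `⊤` because the essentialization of a family of order ideals keeps every
  -- element of the poset.
  enumeration : ∃ (_∈ S) ⤖ ∃ (_∈ ⊤ {n = ∣ S ∣})
  enumeration = ↔⇒⤖ (mk↔ₛ′ (λ x → index S x , ∈⊤) (element S ∘ proj₁)
    (λ y → ∃∈-≡ (index-element S (proj₁ y))) (element-index S))

  label-index∈ : ∀ {X} x → proj₁ x ∈ X → label (index S x) ∈ X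
  label-index∈ {X} x = subst (λ z → proj₁ z ∈ X) (sym (element-index S x))

  -- All labels lie in `S`, so intersecting with `S` loses nothing and being an image becomes a
  -- pointwise condition on labels.
  isImage⁺ : ∀ {X B} → (∀ i → i ∈ B ⇔ label i ∈ X) → IsImage enumeration (X ∩ S) B
  isImage⁺ {X} B⇔X i = mk⇔
    (λ i∈B → element S i , x∈p∩q⁺ (to (B⇔X i) i∈B , label∈ i) , index-element S i)
    (λ { (x , x∈ , refl) →
      from (B⇔X _) (label-index∈ x (proj₁ (x∈p∩q⁻ X S x∈))) })

  isImage⁻ : ∀ {X B} → IsImage enumeration (X ∩ S) B → ∀ i → i ∈ B ⇔ label i ∈ X
  isImage⁻ {X} {B} image i = mk⇔ label∈X
    (λ l∈X → from (image i) (element S i , x∈p∩q⁺ (l∈X , label∈ i) , index-element S i))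
    where
    label∈X : i ∈ B → label i ∈ X
    label∈X i∈B with x , x∈ , refl ← to (image i) i∈B =
      label-index∈ x (proj₁ (x∈p∩q⁻ X S x∈))

-- Essentializations.

-- Elements of an inseparable `Z` lie in the same members of the family, so one in `E′` would equal
-- all the others. Hence any element of `Z` can serve as the one that escapes.
isEssentialization : {𝓛 : Family n} {E′ : Subset n} →
  (∀ e → Separated 𝓛 e ⇔ e ∈ E′) →
  (∀ e f → e ∈ E′ → (∀ W → 𝓛 W → e ∈ W ⇔ f ∈ W) → e ≡ f) →
  IsEssentialization 𝓛 E′
isEssentialization sep⇔ distinguish = record
  { separated  = λ e → from (sep⇔ e)
  ; allButOne  = λ Z ((1<∣Z∣ , insep) , _) →
      let z , z∈Z = ∣p∣>0⇒nonempty Z (<-trans z<s 1<∣Z∣) in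
      z , z∈Z
        , (λ e e∈Z e≢z e∈E′ → e≢z (distinguish e z e∈E′ λ W 𝓛W →
            mk⇔ (λ e∈W → insep e W e∈Z 𝓛W e∈W z∈Z)
                (λ z∈W → insep z W z∈Z 𝓛W z∈W e∈Z)))
        , to (sep⇔ z)
  ; othersKept = λ e sep _ → to (sep⇔ e) sep
  }

-- The ideals `⊤` and `⊥` separate every element, and principal ideals tell any two elements apart
-- by antisymmetry.
orderIdeals-essential : {_≤_ : Rel (Fin m) 0ℓ} → IsDecPartialOrder _≡_ _≤_ →
  IsEssentialization (OrderIdeal _≤_) ⊤
orderIdeals-essential {_≤_ = _≤_} isPoset = isEssentialization
  (λ e → mk⇔ (λ _ → ∈⊤) λ _ → (⊤ , (λ _ _ _ _ → ∈⊤) , ∈⊤)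
                            , (⊥ , (λ _ _ y∈⊥ _ → contradiction y∈⊥ ∉⊥) , ∉⊥))
  (λ e f _ e⇔f → P.antisym
    (∈｛｝⁻ (P._≤? f) (from (e⇔f (↓ f) (↓-ideal f)) (∈｛｝⁺ (P._≤? f) P.refl)))
    (∈｛｝⁻ (P._≤? e) (to (e⇔f (↓ e) (↓-ideal e)) (∈｛｝⁺ (P._≤? e) P.refl))))
  where
  module P = IsDecPartialOrder isPoset

  ↓ : Fin _ → Subset _
  ↓ e = ｛ (λ x → x P.≤? e) ｝

  ↓-ideal : ∀ e → OrderIdeal _≤_ (↓ e)
  ↓-ideal e x y y∈ x≤y = ∈｛｝⁺ (P._≤? e) (P.trans x≤y (∈｛｝⁻ (P._≤? e) y∈))

-- Closures of points under an injective cover-closure.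

module InjectiveCoverClosure (τ : Subset n → Subset n) (isClosure : IsClosureOperator τ)
  (ξ-injective : Injective _≡_ _≡_ (coverClosure τ isClosure)) where

  open IsClosureOperator isClosure

  τ-least : ∀ {A X} → Closed τ X → A ⊆ X → τ A ⊆ X
  τ-least {A} {X} closed A⊆X e∈ = subst (_ ∈_) closed (monotone A X A⊆X e∈)

  closed⁺ : ∀ {X} → τ X ⊆ X → Closed τ X
  closed⁺ {X} τX⊆X = ⊆-antisym τX⊆X (extensive X)

  ⊤-closed : Closed τ ⊤
  ⊤-closed = closed⁺ ⊆⊤

  e∈τ⁅e⁆ : ∀ e → e ∈ τ ⁅ e ⁆
  e∈τ⁅e⁆ e = extensive ⁅ e ⁆ (x∈⁅x⁆ e)

  cov⁺ : ∀ {X e} → e ∉ X → Closed τ (X ∪ ⁅ e ⁆) → e ∈ cov τ X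
  cov⁺ {X} e∉X closed =
    ∈｛｝⁺ (λ e → ¬? (e ∈? X) ×-dec closed? τ (X ∪ ⁅ e ⁆)) (e∉X , closed)

  cov⁻ : ∀ {X e} → e ∈ cov τ X → e ∉ X × Closed τ (X ∪ ⁅ e ⁆)
  cov⁻ {X} = ∈｛｝⁻ (λ e → ¬? (e ∈? X) ×-dec closed? τ (X ∪ ⁅ e ⁆))

  -- Cover-closure depends on `X` only through `cov τ X`.
  cov-injective : ∀ {X Y} → Closed τ X → Closed τ Y → cov τ X ≡ cov τ Y → X ≡ Y
  cov-injective {X} {Y} X-closed Y-closed eq =
    cong proj₁ (ξ-injective {X , X-closed} {Y , Y-closed}
      (cong (λ C → τ C , idempotent C) eq))

  cov-nonempty : ∀ {X e} → Closed τ X → e ∉ X → Nonempty (cov τ X)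
  cov-nonempty {X} {e} closed e∉X = decidable-stable (nonempty? (cov τ X)) λ empty →
    e∉X (subst (e ∈_)
      (sym (cov-injective closed ⊤-closed
        (trans (Empty-unique empty) (sym (Empty-unique λ (_ , f∈) → proj₁ (cov⁻ f∈) ∈⊤)))))
      ∈⊤)

  extend : ∀ {X e} → Closed τ X → e ∉ X →
           ∃[ M ] Closed τ M × X ⊆ M × cov τ M ≡ ⁅ e ⁆
  extend {X} = go X (⊃-wellFounded X)
    where
    go : ∀ X {e} → Acc _⊃_ X → Closed τ X → e ∉ X →
         ∃[ M ] Closed τ M × X ⊆ M × cov τ M ≡ ⁅ e ⁆
    go X {e} (acc rec) closed e∉X
      with any? (λ f → (f ∈? cov τ X) ×-dec ¬? (f ≟ e))
    -- Adding a cover `f ≢ e` gives a strictly larger closed set that still avoids `e`.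
    ... | yes (f , f∈cov , f≢e) =
      let f∉X , X∪f-closed = cov⁻ f∈cov
          M , M-closed , X∪f⊆M , covM = go (X ∪ ⁅ f ⁆)
            (rec (p⊆p∪q ⁅ f ⁆ , f , q⊆p∪q X ⁅ f ⁆ (x∈⁅x⁆ f) , f∉X)) X∪f-closed
            (λ e∈ → [ e∉X , f≢e ∘ sym ∘ x∈⁅y⁆⇒x≡y f ]′ (x∈p∪q⁻ X ⁅ f ⁆ e∈))
      in M , M-closed , X∪f⊆M ∘ p⊆p∪q ⁅ f ⁆ , covM
    -- No cover except `e` remains, and `cov τ X` is nonempty.
    ... | no ¬other = X , closed , (λ x∈ → x∈) ,
      ⊆-antisym (λ f∈ → subst (_∈ ⁅ e ⁆) (sym (only f∈)) (x∈⁅x⁆ e)) (⁅⁆⊆ e∈cov)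
      where
      only : ∀ {f} → f ∈ cov τ X → f ≡ e
      only {f} f∈ = decidable-stable (f ≟ e) λ f≢e → ¬other (f , f∈ , f≢e)
      e∈cov : e ∈ cov τ X
      e∈cov = let f , f∈ = cov-nonempty closed e∉X in subst (_∈ cov τ X) (only f∈) f∈

  -- Enlarging `X` ends in a closed set whose only cover is `e`, which must be `M`. So `M` is the
  -- largest closed set avoiding `e`.
  avoiding-⊆ : ∀ {X M e} → Closed τ M → cov τ M ≡ ⁅ e ⁆ → Closed τ X → e ∉ X → X ⊆ M
  avoiding-⊆ {X} M-closed covM X-closed e∉X =
    let M′ , M′-closed , X⊆M′ , covM′ = extend X-closed e∉X
    in subst (X ⊆_) (cov-injective M′-closed M-closed (trans covM′ (sym covM))) X⊆M′

  -- If every `τ ⁅ a ⁆` avoids `e`, each lies in the largest closed set `M` avoiding `e`. Then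
  -- `τ A ⊆ M`, which excludes `e`.
  τ-pointwise : ∀ A {e} → e ∈ τ A → e ∉ τ ⊥ → ∃[ a ] a ∈ A × e ∈ τ ⁅ a ⁆
  τ-pointwise A {e} e∈τA e∉τ⊥ =
    decidable-stable (any? λ a → (a ∈? A) ×-dec (e ∈? τ ⁅ a ⁆)) λ none →
    let M , M-closed , _ , covM = extend (idempotent ⊥) e∉τ⊥
        A⊆M : A ⊆ M
        A⊆M {a} a∈A = avoiding-⊆ M-closed covM (idempotent ⁅ a ⁆)
          (λ e∈ → none (a , a∈A , e∈)) (e∈τ⁅e⁆ a)
    in proj₁ (cov⁻ (subst (e ∈_) (sym covM) (x∈⁅x⁆ e))) (τ-least M-closed A⊆M e∈τA)

  -- With `cov τ M ≡ ⁅ e ⁆`, the closed set `M ∪ ⁅ e ⁆` contains `τ ⁅ e ⁆` and hence `f`. But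
  -- `f ∈ M` would force `e ∈ M`.
  τ⁅⁆-antisym : ∀ {e f} → e ∉ τ ⊥ → e ∈ τ ⁅ f ⁆ → f ∈ τ ⁅ e ⁆ → e ≡ f
  τ⁅⁆-antisym {e} {f} e∉τ⊥ e∈τf f∈τe with M , M-closed , _ , covM ← extend (idempotent ⊥) e∉τ⊥
    with e∉M , M∪e-closed ← cov⁻ {M} (subst (e ∈_) (sym covM) (x∈⁅x⁆ e))
    with x∈p∪q⁻ M ⁅ e ⁆ (τ-least M∪e-closed (q⊆p∪q M ⁅ e ⁆) f∈τe)
  ... | inj₁ f∈M = contradiction (τ-least M-closed (⁅⁆⊆ f∈M) e∈τf) e∉M
  ... | inj₂ f∈e = sym (x∈⁅y⁆⇒x≡y e f∈e)

  -- Every closed set contains `τ ⊥`, so exactly the elements outside it are separated, by `⊤` and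
  -- `τ ⊥`. Closures of points tell them apart.
  closed-essential : IsEssentialization (Closed τ) (∁ (τ ⊥))
  closed-essential = isEssentialization
    (λ e → mk⇔
      (λ (_ , Y , Y-closed , e∉Y) → x∉p⇒x∈∁p (e∉Y ∘ τ-least Y-closed ⊥⊆))
      (λ e∈ → (⊤ , ⊤-closed , ∈⊤) , (τ ⊥ , idempotent ⊥ , x∈∁p⇒x∉p e∈)))
    (λ e f e∈ e⇔f → τ⁅⁆-antisym (x∈∁p⇒x∉p e∈)
      (from (e⇔f _ (idempotent ⁅ f ⁆)) (e∈τ⁅e⁆ f))
      (to (e⇔f _ (idempotent ⁅ e ⁆)) (e∈τ⁅e⁆ e)))

  -- The poset and its order ideals.

  open Enumeration (∁ (τ ⊥))

  label∉ : ∀ i → label i ∉ τ ⊥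
  label∉ i = x∈∁p⇒x∉p (label∈ i)

  label-surj : ∀ {e} → e ∉ τ ⊥ → ∃[ i ] label i ≡ e
  label-surj = label-surjective ∘ x∉p⇒x∈∁p

  _≤_ : Rel (Fin ∣ ∁ (τ ⊥) ∣) 0ℓ
  i ≤ j = label i ∈ τ ⁅ label j ⁆

  ≤-isDecPartialOrder : IsDecPartialOrder _≡_ _≤_
  ≤-isDecPartialOrder = record
    { isPartialOrder = record
      { isPreorder = record
        { isEquivalence = isEquivalence
        ; reflexive     = λ { {i} refl → e∈τ⁅e⁆ (label i) }
        ; trans         = λ i≤j j≤k → τ-least (idempotent _) (⁅⁆⊆ j≤k) i≤j
        }
      ; antisym = λ {i} i≤j j≤i → label-injective (τ⁅⁆-antisym (label∉ i) i≤j j≤i)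
      }
    ; _≟_  = _≟_
    ; _≤?_ = λ i j → label i ∈? τ ⁅ label j ⁆
    }

  ⟦_⟧ : Subset ∣ ∁ (τ ⊥) ∣ → Subset n
  ⟦ I ⟧ = ｛ (λ e → any? (λ i → (i ∈? I) ×-dec (label i ≟ e))) ｝

  -- Outside `τ ⊥`, closing `⟦ I ⟧` adds only points below members of `I`, which an ideal already
  -- contains.
  ideal⇔τ⟦⟧ : ∀ {I} → OrderIdeal _≤_ I → ∀ i → i ∈ I ⇔ label i ∈ τ ⟦ I ⟧
  ideal⇔τ⟦⟧ {I} ideal i = mk⇔
    (λ i∈I → extensive ⟦ I ⟧ (∈｛｝⁺ image? (i , i∈I , refl)))
    (λ l∈τ → let a , a∈⟦I⟧ , l∈τa = τ-pointwise ⟦ I ⟧ l∈τ (label∉ i)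
                 j , j∈I , lj≡a = ∈｛｝⁻ image? a∈⟦I⟧
             in ideal i j j∈I (subst (λ a → label i ∈ τ ⁅ a ⁆) (sym lj≡a) l∈τa))
    where
    image? : Decidable (λ e → ∃[ i ] i ∈ I × label i ≡ e)
    image? e = any? (λ i → (i ∈? I) ×-dec (label i ≟ e))

  isomorphism : Isomorphism (Closed τ) (OrderIdeal _≤_)
  isomorphism = record
    { E₁′        = ∁ (τ ⊥)
    ; E₂′        = ⊤
    ; essential₁ = closed-essential
    ; essential₂ = orderIdeals-essential ≤-isDecPartialOrder
    ; φ          = enumeration
    ; image      =
        (λ { {B} (_ , (X , X-closed , refl) , image) →
          let B⇔X = isImage⁻ {X} image in
          -- A closed set containing a point contains its closure, so its trace on the poset is
          -- downward closed.
          B , (λ i j j∈B i≤j →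
                 from (B⇔X i) (τ-least X-closed (⁅⁆⊆ (to (B⇔X j) j∈B)) i≤j))
            , sym (∩-identityʳ B) })
      , (λ { (I , ideal , refl) →
          τ ⟦ I ⟧ ∩ ∁ (τ ⊥) , (τ ⟦ I ⟧ , idempotent ⟦ I ⟧ , refl) ,
          isImage⁺ (subst (λ B → ∀ i → i ∈ B ⇔ label i ∈ τ ⟦ I ⟧)
            (sym (∩-identityʳ I)) (ideal⇔τ⟦⟧ ideal)) })
    }

  -- Cover-closure as rowmotion.

  open Isomorphism isomorphism using (Identified)

  -- The covers of `X` are the labels of the minimal elements of `∁ I`, and by `τ-pointwise` their
  -- closure is, on labels, the ideal they generate.
  rowmotion⇔τcov : ∀ {X I} → Closed τ X → (∀ i → i ∈ I ⇔ label i ∈ X) →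
    ∀ i → i ∈ rowmotion ≤-isDecPartialOrder I ⇔ label i ∈ τ (cov τ X)
  rowmotion⇔τcov {X} {I} X-closed I⇔X i = mk⇔ forth back
    where
    open IsDecPartialOrder ≤-isDecPartialOrder using (_≤?_)

    -- These predicates and decisions repeat those inside `minimals` and `idealGeneratedBy`, so that
    -- membership there can be introduced and eliminated.
    Minimal : Pred (Fin _) 0ℓ
    Minimal j = j ∈ ∁ I × (∀ k → k ∈ ∁ I → k ≤ j → k ≡ j)

    minimal? : Decidable Minimal
    minimal? j = (j ∈? ∁ I) ×-dec
      all? (λ k → (k ∈? ∁ I) →-dec ((k ≤? j) →-dec (k ≟ j)))

    generated? : Decidable (λ i → ∃[ j ] j ∈ minimals ≤-isDecPartialOrder (∁ I) × i ≤ j)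
    generated? i = any? (λ j → (j ∈? minimals ≤-isDecPartialOrder (∁ I)) ×-dec (i ≤? j))

    -- A point that closing adds to `X ∪ ⁅ label j ⁆` would lie outside `X` and below `j`, so
    -- minimality makes it `label j`.
    minimal⇒cov : ∀ {j} → Minimal j → label j ∈ cov τ X
    minimal⇒cov {j} (j∈∁I , below) =
      cov⁺ (x∈∁p⇒x∉p j∈∁I ∘ from (I⇔X j)) (closed⁺ τ⊆)
      where
      τ⊆ : τ (X ∪ ⁅ label j ⁆) ⊆ X ∪ ⁅ label j ⁆
      τ⊆ {e} e∈τ with e ∈? X
      ... | yes e∈X = p⊆p∪q ⁅ label j ⁆ e∈X
      ... | no e∉X
        with e∉τ⊥ ← e∉X ∘ τ-least X-closed ⊥⊆
        with k , refl ← label-surj e∉τ⊥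
        with a , a∈ , e∈τa ← τ-pointwise (X ∪ ⁅ label j ⁆) e∈τ e∉τ⊥
        with x∈p∪q⁻ X ⁅ label j ⁆ a∈
      ... | inj₁ a∈X = contradiction (τ-least X-closed (⁅⁆⊆ a∈X) e∈τa) e∉X
      ... | inj₂ a∈j with refl ← x∈⁅y⁆⇒x≡y (label j) a∈j
        with refl ← below k (x∉p⇒x∈∁p (e∉X ∘ to (I⇔X k))) e∈τa =
        q⊆p∪q X ⁅ label j ⁆ (x∈⁅x⁆ (label j))

    -- Everything below `j` has its label in the closed set `X ∪ ⁅ label j ⁆`, so outside `I` only
    -- `j` itself is left.
    cov⇒minimal : ∀ {j} → label j ∈ cov τ X → Minimal j
    cov⇒minimal {j} lj∈cov with lj∉X , X∪j-closed ← cov⁻ {X} lj∈cov =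
      x∉p⇒x∈∁p (lj∉X ∘ to (I⇔X j)) , λ k k∈∁I k≤j →
        [ (λ lk∈X → contradiction (from (I⇔X k) lk∈X) (x∈∁p⇒x∉p k∈∁I))
        , label-injective ∘ x∈⁅y⁆⇒x≡y (label j)
        ]′ (x∈p∪q⁻ X ⁅ label j ⁆ (τ-least X∪j-closed (q⊆p∪q X ⁅ label j ⁆) k≤j))

    forth : i ∈ rowmotion ≤-isDecPartialOrder I → label i ∈ τ (cov τ X)
    forth i∈ =
      let j , j∈min , i≤j = ∈｛｝⁻ generated? i∈
      in monotone ⁅ label j ⁆ (cov τ X) (⁅⁆⊆ (minimal⇒cov (∈｛｝⁻ minimal? j∈min))) i≤j

    back : label i ∈ τ (cov τ X) → i ∈ rowmotion ≤-isDecPartialOrder I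
    back l∈τ with a , a∈cov , l∈τa ← τ-pointwise (cov τ X) l∈τ (label∉ i)
      -- A cover of `X` lies outside `X`, hence outside `τ ⊥`, so it has a label.
      with j , refl ← label-surj (proj₁ (cov⁻ {X} a∈cov) ∘ τ-least X-closed ⊥⊆) =
      ∈｛｝⁺ generated? (j , ∈｛｝⁺ minimal? (cov⇒minimal a∈cov) , l∈τa)

  identified-rowmotion : ∀ {X I} → Closed τ X → Identified X I →
    Identified (τ (cov τ X)) (rowmotion ≤-isDecPartialOrder I)
  identified-rowmotion {X} {I} X-closed identified =
    -- `Identified` speaks of `I ∩ ⊤`, so the intersection is removed before and restored after.
    isImage⁺ (subst (λ B → ∀ i → i ∈ B ⇔ label i ∈ τ (cov τ X)) (sym (∩-identityʳ _))
      (rowmotion⇔τcov X-closed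
        (subst (λ B → ∀ i → i ∈ B ⇔ label i ∈ X) (∩-identityʳ I) (isImage⁻ identified))))

corollary4p9 : ∀ (n : ℕ) (τ : Subset n → Subset n) (isClosure : IsClosureOperator τ) →
    Bijective _≡_ _≡_ (coverClosure τ isClosure) →
    ∃ λ (m : ℕ) →
    Σ (Rel (Fin m) 0ℓ) λ _≤_ →
    Σ (IsDecPartialOrder _≡_ _≤_) λ isPoset →
    Σ (Isomorphism (Closed τ) (OrderIdeal _≤_)) λ iso →
    ∀ (X : ∃ (Closed τ)) (I : Subset m) → OrderIdeal _≤_ I →
    Isomorphism.Identified iso (proj₁ X) I →
    Isomorphism.Identified iso
    (proj₁ (coverClosure τ isClosure X)) (rowmotion isPoset I)
corollary4p9 n τ isClosure (ξ-injective , _) =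
  ∣ ∁ (τ ⊥) ∣ , _≤_ , ≤-isDecPartialOrder , isomorphism ,
  λ (X , X-closed) I _ → identified-rowmotion X-closed
  where open InjectiveCoverClosure τ isClosure ξ-injective
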